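{- Let $\mathcal{F}$ be a forbidden family and let $k,d\in\mathbb{N}$. Let $G_1,G_2,\dots,G_d$ be graphs, each with $\mathcal{F}$-free chromatic span $\Lambda(G_i,\mathcal{F})\leq k$ (which is implied if $\chi(G_i,\mathcal{F})\leq k+1$). Let $S=\{s_1,s_2,\dots,s_d\}$ be a $k$-multiplicative Sidon set with $d$ (distinct) elements. Then $$\Lambda(G_1\,\square\,G_2\,\square\cdots\square\,G_d,\mathcal{F})\leq k\cdot\max S.$$
   Context: All graphs are finite, simple, undirected (with non-empty vertex set). $\mathbb{N}=\{1,2,\dots\}$ and $[k]=\{1,\dots,k\}$. A set $A\subseteq\mathbb{N}$ is $k$-multiplicative Sidon if for all $x,y\in A$ and all $a,b\in[k]$, $ax=by$ implies $a=b$ and $x=y$. A colouring of a graph $G$ is a function $c:V(G)\to\mathbb{Z}$ with $c(v)\neq c(w)$ for every edge $vw\in E(G)$; it is a $k$-colouring if it takes at most $k$ distinct values. The span of $c$ is $\max\{|c(v)-c(w)|:vw\in E(G)\}$ (taken to be $0$ if $G$ has no edges). A forbidden family $\mathcal{F}$ is a family of connected bipartite graphs, each with at least three vertices. A colouring $c$ of $G$ is $\mathcal{F}$-free if $|\{c(v):v\in V(H)\}|\geq 3$ for every (not necessarily induced) subgraph $H$ of $G$ that is isomorphic to a graph in $\mathcal{F}$. The $\mathcal{F}$-free chromatic number $\chi(G,\mathcal{F})$ is the minimum integer $k$ such that $G$ has an $\mathcal{F}$-free $k$-colouring. The $\mathcal{F}$-free chromatic span $\Lambda(G,\mathcal{F})$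 is the minimum integer $k$ such that $G$ has an $\mathcal{F}$-free colouring with span $k$. The cartesian product $G_1\,\square\,G_2\,\square\cdots\square\,G_d$ has vertex set $V(G_1)\times\cdots\times V(G_d)$, where $(v_1,\dots,v_d)$ and $(w_1,\dots,w_d)$ are adjacent if and only if $v_iw_i\in E(G_i)$ for some $i$ and $v_j=w_j$ for all $j\neq i$. -}

module Defs where

open import Data.Bool using (Bool; true; false; T)
open import Data.Fin as Fin using (Fin; zero; suc)
open import Data.Fin.Properties as Fin using (all?; any?; 1↔⊤; 0↔⊥; +↔⊎; *↔×)
open import Data.Integer using (ℤ; ∣_∣; _-_)
import Data.Integer as ℤ
open import Data.List using (List; length; map; filter; allFin; cartesianProduct; deduplicate)
open import Data.List.Extrema.Nat using (max)
open import Data.Nat using (ℕ; suc; _+_; _*_; _≤_)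
open import Data.Product using (Σ; ∃; _×_; _,_; proj₁; proj₂; map₂)
open import Data.Product.Function.Dependent.Propositional using (Σ-↔)
open import Data.Product.Function.NonDependent.Propositional using (_×-↔_)
open import Data.Sum using (_⊎_; inj₁; inj₂)
open import Data.Sum.Function.Propositional using (_⊎-↔_)
open import Data.Unit using (⊤; tt)
open import Data.Vec using (Vec; []; _∷_; lookup)
open import Function using (_∘_)
open import Function.Bundles using (_↔_; _⇔_; Inverse; mk↔ₛ′)
open import Function.Properties.Inverse using (↔-refl; ↔-sym; ↔-trans; ↔⇒↣)
open import Level using (Level; 0ℓ; _⊔_) renaming (suc to lsuc)
open import Relation.Binary.Core using (Rel)
open import Relation.Binary.Definitions using (Decidable; DecidableEquality; Symmetric; Irreflexive)
open import Relation.Binary.Construct.Closure.ReflexiveTransitive using (Star)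
open import Relation.Binary.PropositionalEquality using (_≡_; _≢_; refl; sym)
open import Relation.Nullary using (¬_; ¬?; _×-dec_; _→-dec_)
open import Relation.Nullary.Decidable using (via-injection; T?)
open import Relation.Unary using (Pred)

private variable
  ℓ : Level

record Graph : Set₁ where
  field
    V        : Set
    order    : ℕ
    finite   : V ↔ Fin order
    nonempty : V
    Adj      : Rel V 0ℓ
    Adj?     : Decidable Adj
    Adj-sym  : Symmetric Adj
    Adj-irr  : Irreflexive _≡_ Adj

  _≟V_ : DecidableEquality V
  _≟V_ = via-injection (↔⇒↣ finite) Fin._≟_

  vertices : List V
  vertices = map (Inverse.from finite) (allFin order)

  -- Each edge is listed once in each direction.
  edges : List (V × V)
  edges = filter (λ (v , w) → Adj? v w) (cartesianProduct vertices vertices)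

open Graph public using (V; Adj; order; vertices; edges)

record _≅_ (G H : Graph) : Set where
  field
    bijection : V G ↔ V H
    adjacency : ∀ v w → Adj G v w ⇔ Adj H (Inverse.to bijection v) (Inverse.to bijection w)

Connected : Graph → Set
Connected G = ∀ v w → Star (Adj G) v w

Bipartite : Graph → Set
Bipartite G = ∃ λ (side : V G → Bool) → ∀ {v w} → Adj G v w → side v ≢ side w

Σ-zero-suc : ∀ {n} {P : Fin (suc n) → Set} → Σ (Fin (suc n)) P ↔ (P zero ⊎ Σ (Fin n) (P ∘ suc))
Σ-zero-suc = mk↔ₛ′
  (λ { (zero , p) → inj₁ p ; (suc i , p) → inj₂ (i , p) })
  (λ { (inj₁ p) → zero , p ; (inj₂ (i , p)) → suc i , p })
  (λ { (inj₁ p) → refl ; (inj₂ (i , p)) → refl })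
  (λ { (zero , p) → refl ; (suc i , p) → refl })

T-finite : ∀ b → ∃ λ n → T b ↔ Fin n
T-finite true  = 1 , ↔-sym 1↔⊤
T-finite false = 0 , ↔-sym 0↔⊥

filter-Fin-finite : ∀ n (p : Fin n → Bool) → ∃ λ m → Σ (Fin n) (T ∘ p) ↔ Fin m
filter-Fin-finite 0 p = 0 , mk↔ₛ′ (λ ()) (λ ()) (λ ()) (λ ())
filter-Fin-finite (suc n) p with T-finite (p zero) | filter-Fin-finite n (p ∘ suc)
... | a , T↔a | b , rest↔b = a + b , ↔-trans Σ-zero-suc (↔-trans (T↔a ⊎-↔ rest↔b) (↔-sym +↔⊎))

filter-finite : ∀ {A : Set} {n} → A ↔ Fin n → (p : A → Bool) → ∃ λ m → Σ A (T ∘ p) ↔ Fin m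
filter-finite A↔n p =
  map₂ (↔-trans (↔-sym (Σ-↔ (↔-sym A↔n) ↔-refl))) (filter-Fin-finite _ (p ∘ Inverse.from A↔n))

-- Bool-valued, so that the vertices of a subgraph again form a finite type.
record Subgraph (G : Graph) : Set where
  field
    inV      : V G → Bool
    inE      : V G → V G → Bool
    nonempty : Σ (V G) (T ∘ inV)
    E⊆Adj    : ∀ {v w} → T (inE v w) → Adj G v w
    E⊆V      : ∀ {v w} → T (inE v w) → T (inV v) × T (inV w)
    E-sym    : ∀ {v w} → T (inE v w) → T (inE w v)

  graph : Graph
  graph = record
    { V        = Σ (V G) (T ∘ inV)
    ; order    = proj₁ (filter-finite (Graph.finite G) inV)
    ; finite   = proj₂ (filter-finite (Graph.finite G) inV)
    ; nonempty = nonempty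
    ; Adj      = λ (v , _) (w , _) → T (inE v w)
    ; Adj?     = λ (v , _) (w , _) → T? (inE v w)
    ; Adj-sym  = E-sym
    ; Adj-irr  = λ { refl e → Graph.Adj-irr G refl (E⊆Adj e) }
    }

□-V : ∀ {d} → Vec Graph d → Set
□-V []       = ⊤
□-V (G ∷ Gs) = V G × □-V Gs

π : ∀ {d} (Gs : Vec Graph d) → □-V Gs → (i : Fin d) → V (lookup Gs i)
π (G ∷ Gs) (v , vs) zero    = v
π (G ∷ Gs) (v , vs) (suc i) = π Gs vs i

□-finite : ∀ {d} (Gs : Vec Graph d) → ∃ λ n → □-V Gs ↔ Fin n
□-finite []       = 1 , ↔-sym 1↔⊤
□-finite (G ∷ Gs) with □-finite Gs
... | n , Gs↔n = order G * n , ↔-trans (Graph.finite G ×-↔ Gs↔n) (↔-sym *↔×)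

□-nonempty : ∀ {d} (Gs : Vec Graph d) → □-V Gs
□-nonempty []       = tt
□-nonempty (G ∷ Gs) = Graph.nonempty G , □-nonempty Gs

□-Adj : ∀ {d} (Gs : Vec Graph d) → Rel (□-V Gs) 0ℓ
□-Adj Gs v w = ∃ λ i →
  Adj (lookup Gs i) (π Gs v i) (π Gs w i) × (∀ j → j ≢ i → π Gs v j ≡ π Gs w j)

□ : ∀ {d} → Vec Graph d → Graph
□ Gs = record
  { V        = □-V Gs
  ; order    = proj₁ (□-finite Gs)
  ; finite   = proj₂ (□-finite Gs)
  ; nonempty = □-nonempty Gs
  ; Adj      = □-Adj Gs
  ; Adj?     = λ v w → any? λ i →
      Graph.Adj? (lookup Gs i) (π Gs v i) (π Gs w i) ×-dec
      all? λ j → ¬? (j Fin.≟ i) →-dec Graph._≟V_ (lookup Gs j) (π Gs v j) (π Gs w j)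
  ; Adj-sym  = λ (i , e , eq) → i , Graph.Adj-sym (lookup Gs i) e , λ j j≢i → sym (eq j j≢i)
  ; Adj-irr  = λ { refl (i , e , _) → Graph.Adj-irr (lookup Gs i) refl e }
  }

Proper : (G : Graph) → (V G → ℤ) → Set
Proper G c = ∀ {v w} → Adj G v w → c v ≢ c w

numColours : (G : Graph) → (V G → ℤ) → ℕ
numColours G c = length (deduplicate ℤ._≟_ (map c (vertices G)))

span : (G : Graph) → (V G → ℤ) → ℕ
span G c = max 0 (map (λ (v , w) → ∣ c v - c w ∣) (edges G))

ForbiddenFamily : Pred Graph ℓ → Set (lsuc 0ℓ ⊔ ℓ)
ForbiddenFamily 𝓕 = ∀ H → 𝓕 H → Connected H × Bipartite H × 3 ≤ order H

Free : Pred Graph ℓ → (G : Graph) → (V G → ℤ) → Set (lsuc 0ℓ ⊔ ℓ)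
Free 𝓕 G c = (S : Subgraph G) → (∃ λ H → 𝓕 H × Subgraph.graph S ≅ H) →
             3 ≤ numColours (Subgraph.graph S) (c ∘ proj₁)

IsMinimum : Pred ℕ ℓ → Pred ℕ ℓ
IsMinimum P m = P m × (∀ n → P n → m ≤ n)

-- `χ G 𝓕 m` and `Λ G 𝓕 m` say that the F-free chromatic number, respectively
-- span, is m. They are (functional) relations rather than ℕ-valued functions,
-- because 𝓕 is arbitrary and so the minima exist only classically.
χ : Graph → (𝓕 : Pred Graph ℓ) → Pred ℕ (lsuc 0ℓ ⊔ ℓ)
χ G 𝓕 = IsMinimum λ k → ∃ λ c → Proper G c × Free 𝓕 G c × numColours G c ≤ k

Λ : Graph → (𝓕 : Pred Graph ℓ) → Pred ℕ (lsuc 0ℓ ⊔ ℓ)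
Λ G 𝓕 = IsMinimum λ k → ∃ λ c → Proper G c × Free 𝓕 G c × span G c ≡ k

-- For such a classically existing number Q: it exists and is at most n.
-- The double negation makes this the classical existential quantifier.
infix 4 _≼_
_≼_ : Pred ℕ ℓ → ℕ → Set ℓ
Q ≼ n = ¬ ¬ (∃ λ m → Q m × m ≤ n)

-- Sidon sets consist of positive integers, hence the first clause.
Sidon : ℕ → Pred ℕ 0ℓ → Set
Sidon k A =
  (∀ x → A x → 1 ≤ x) ×
  (∀ x y a b → A x → A y → 1 ≤ a × a ≤ k → 1 ≤ b × b ≤ k → a * x ≡ b * y → a ≡ b × x ≡ y)

{-# OPTIONS --safe #-}

-- Give v = (v₁, …, v_d) the colour s₁c₁(v₁) + … + s_dc_d(v_d). An edge in
-- direction i then has colour difference s_i t with 1 ≤ t ≤ k, so the Sidon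
-- property makes the direction of an edge recoverable from that difference. On a
-- 2-coloured subgraph all edges have the same difference; if the subgraph is
-- connected, it therefore lies in a single fibre, that is, in a copy of some G_i,
-- where the colouring is an injective function of the 𝓕-free colouring c_i.
module Submission where

open import Defs
open import Data.Bool using (T)
open import Data.Bool.Properties using (T-irrelevant)
open import Data.Empty using (⊥-elim)
open import Data.Fin as Fin using (Fin; zero; suc; toℕ; fromℕ<)
open import Data.Fin.Properties as Fin using (injective⇒≤; pigeonhole; sequence; toℕ<n; toℕ-injective; fromℕ<-injective)
open import Data.Integer using (ℤ; ∣_∣; _-_; 0ℤ; +_)
import Data.Integer as ℤ
import Data.Integer.Properties as ℤ
open import Data.Integer.Tactic.RingSolver using (solve-∀)
open import Data.List as List using (List; []; _∷_; map; deduplicate)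
open import Data.List.Extrema.Nat using (max; max≤v⁺; xs≤max)
open import Data.List.Membership.Propositional using () renaming (_∈_ to _∈ˡ_)
open import Data.List.Membership.Propositional.Properties
  using (∈-map⁺; ∈-map⁻; ∈-allFin; ∈-filter⁺; ∈-filter⁻; ∈-cartesianProduct⁺; ∈-deduplicate⁺; ∈-deduplicate⁻; ∈-lookup)
import Data.List.Relation.Unary.All as All
open import Data.List.Relation.Unary.All.Properties using (map⁺; map⁻)
open import Data.List.Relation.Unary.AllPairs using (_∷_)
import Data.List.Relation.Unary.Any as Any
open import Data.List.Relation.Unary.Any.Properties using (lookup-index)
open import Data.List.Relation.Unary.Unique.DecPropositional.Properties ℤ._≟_ using (deduplicate-!)
open import Data.List.Relation.Unary.Unique.Propositional using () renaming (Unique to Uniqueˡ)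
open import Data.Nat using (ℕ; suc; _*_; _≤_; _<_; z≤n; s≤s; s≤s⁻¹; _≤?_; >-nonZero)
open import Data.Nat.Induction using (<-rec)
import Data.Nat.Properties as ℕ
open import Data.Product using (∃; ∃₂; _×_; _,_; proj₁; proj₂)
open import Data.Sum using (_⊎_; inj₁; inj₂)
open import Data.Vec using (Vec; []; _∷_; lookup; toList)
open import Data.Vec.Membership.Propositional using (_∈_)
import Data.Vec.Membership.Propositional.Properties as Vec
open import Data.Vec.Relation.Unary.Unique.Propositional using (Unique)
open import Data.Vec.Relation.Unary.Unique.Propositional.Properties using (lookup-injective)
open import Effect.Monad using (RawMonad)
open import Function using (_∘_; id)
open import Function.Bundles using (Inverse; Equivalence; mk⇔; mk↔ₛ′)
open import Function.Properties.Equivalence using () renaming (trans to ⇔-trans)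
open import Function.Properties.Inverse using (↔-trans)
open import Level using (Level)
open import Relation.Binary.Construct.Closure.ReflexiveTransitive using (Star; ε; _◅_; gmap)
open import Relation.Binary.PropositionalEquality
  using (_≡_; _≢_; refl; sym; trans; cong; cong₂; subst; subst₂)
open import Relation.Nullary using (yes; no; contradiction)
open import Relation.Nullary.Decidable using (decidable-stable)
open import Relation.Nullary.Negation using (¬¬-Monad)
open import Relation.Unary using (Pred)

private variable
  a ℓ : Level
  A : Set a

-- Classical existence of minima

-- Strong induction under the assumption `none` that no minimum up to `n` exists: a witness `m`
-- below `n` would yield one by induction, so `n` itself is minimal. Comparing `n` with `m` is
-- decidable, so this indirect argument suffices.
minimum-≼ : (P : Pred ℕ ℓ) → ∀ n → P n → IsMinimum P ≼ n
minimum-≼ P = <-rec (λ n → P n → IsMinimum P ≼ n) λ n rec Pn none →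
  none (n , (Pn , λ m Pm → decidable-stable (n ≤? m) λ n≰m →
    rec (ℕ.≰⇒> n≰m) Pm λ (l , min , l≤m) →
      none (l , min , ℕ.≤-trans l≤m (ℕ.<⇒≤ (ℕ.≰⇒> n≰m)))) , ℕ.≤-refl)

-- Edges, spans and colour counts

lookup-unique : ∀ {xs : List A} → Uniqueˡ xs → ∀ i j → List.lookup xs i ≡ List.lookup xs j → i ≡ j
lookup-unique (_ ∷ _)     zero    zero    _  = refl
lookup-unique (x∉ ∷ _)    zero    (suc j) eq = contradiction eq (All.lookup x∉ (∈-lookup j))
lookup-unique (x∉ ∷ _)    (suc i) zero    eq = contradiction (sym eq) (All.lookup x∉ (∈-lookup i))
lookup-unique (_ ∷ xs!)   (suc i) (suc j) eq = cong suc (lookup-unique xs! i j eq)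

module _ (G : Graph) where

  ∈-vertices : ∀ v → v ∈ˡ vertices G
  ∈-vertices v = subst (_∈ˡ vertices G) (Inverse.strictlyInverseʳ (Graph.finite G) v)
    (∈-map⁺ (Inverse.from (Graph.finite G)) (∈-allFin _))

  ∈-edges⁺ : ∀ {v w} → Adj G v w → (v , w) ∈ˡ edges G
  ∈-edges⁺ = ∈-filter⁺ (λ (v , w) → Graph.Adj? G v w) (∈-cartesianProduct⁺ (∈-vertices _) (∈-vertices _))

  ∈-edges⁻ : ∀ {v w} → (v , w) ∈ˡ edges G → Adj G v w
  ∈-edges⁻ vw∈ = proj₂ (∈-filter⁻ (λ (v , w) → Graph.Adj? G v w)
    {xs = List.cartesianProduct (vertices G) (vertices G)} vw∈)

  module _ (c : V G → ℤ) where

    ∣c-c∣≤span : ∀ {v w} → Adj G v w → ∣ c v - c w ∣ ≤ span G c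
    ∣c-c∣≤span e = All.lookup (map⁻ (xs≤max 0 (map _ (edges G)))) (∈-edges⁺ e)

    span-lub : ∀ {n} → (∀ {v w} → Adj G v w → ∣ c v - c w ∣ ≤ n) → span G c ≤ n
    -- `z≤n` covers the default value 0 of `max`, which is the span of an edgeless graph.
    span-lub bound = max≤v⁺ {xs = map _ (edges G)} z≤n
      (map⁺ {xs = edges G} (All.tabulate λ {(v , w)} vw∈ → bound {v} {w} (∈-edges⁻ vw∈)))

    private
      palette : List ℤ
      palette = deduplicate ℤ._≟_ (map c (vertices G))

      c∈palette : ∀ v → c v ∈ˡ palette
      c∈palette v = ∈-deduplicate⁺ ℤ._≟_ (∈-map⁺ c (∈-vertices v))

    -- Together with `representative`, this turns the counting of colours into the construction of
    -- injections between finite types.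
    colourIndex : V G → Fin (numColours G c)
    colourIndex v = Any.index (c∈palette v)

    lookup-colourIndex : ∀ v → List.lookup palette (colourIndex v) ≡ c v
    lookup-colourIndex v = sym (lookup-index (c∈palette v))

    colourIndex-injective : ∀ {v w} → colourIndex v ≡ colourIndex w → c v ≡ c w
    colourIndex-injective {v} {w} eq =
      trans (sym (lookup-colourIndex v)) (trans (cong (List.lookup palette) eq) (lookup-colourIndex w))

    private
      representative′ : ∀ i → ∃ λ v → v ∈ˡ vertices G × List.lookup palette i ≡ c v
      representative′ i = ∈-map⁻ c (∈-deduplicate⁻ ℤ._≟_ _ (∈-lookup i))

    representative : Fin (numColours G c) → V G
    representative i = proj₁ (representative′ i)

    representative-injective : ∀ {i j} → c (representative i) ≡ c (representative j) → i ≡ j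
    representative-injective {i} {j} eq = lookup-unique (deduplicate-! (map c (vertices G))) i j
      (trans (proj₂ (proj₂ (representative′ i))) (trans eq (sym (proj₂ (proj₂ (representative′ j))))))

-- Pick a vertex of each colour of `c`, move it along `φ` and read off its colour under `c′`:
-- distinct colours stay distinct because `φ` reflects equality of colours.
numColours-mono : ∀ G H {c : V G → ℤ} {c′ : V H → ℤ} (φ : V G → V H) →
                  (∀ {v w} → c′ (φ v) ≡ c′ (φ w) → c v ≡ c w) → numColours G c ≤ numColours H c′
numColours-mono G H {c} {c′} φ reflects =
  injective⇒≤ {f = colourIndex H c′ ∘ φ ∘ representative G c}
    (representative-injective G c ∘ reflects ∘ colourIndex-injective H c′)

-- Colourings with fewer than three colours

module _ (G : Graph) (c : V G → ℤ) (few : numColours G c < 3) where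

  two-of-three-agree : ∀ x y z → c x ≡ c y ⊎ c x ≡ c z ⊎ c y ≡ c z
  two-of-three-agree x y z = agree (pigeonhole few (colourIndex G c ∘ lookup (x ∷ y ∷ z ∷ [])))
    where
    agree : (∃₂ λ i j → i Fin.< j × colourIndex G c (lookup (x ∷ y ∷ z ∷ []) i) ≡ colourIndex G c (lookup (x ∷ y ∷ z ∷ []) j)) →
            c x ≡ c y ⊎ c x ≡ c z ⊎ c y ≡ c z
    agree (zero , suc zero , _ , eq)             = inj₁ (colourIndex-injective G c eq)
    agree (zero , suc (suc zero) , _ , eq)       = inj₂ (inj₁ (colourIndex-injective G c eq))
    agree (suc zero , suc (suc zero) , _ , eq)   = inj₂ (inj₂ (colourIndex-injective G c eq))
    agree (zero , zero , () , _)
    agree (suc zero , zero , () , _)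
    agree (suc zero , suc zero , s≤s () , _)
    agree (suc (suc zero) , zero , () , _)
    agree (suc (suc zero) , suc zero , s≤s () , _)
    agree (suc (suc zero) , suc (suc zero) , s≤s (s≤s ()) , _)

  -- Both pairs carry the only two colours available, so they match either directly or crosswise,
  -- and the absolute value ignores the swap.
  difference-unique : ∀ {v w x y} → c v ≢ c w → c x ≢ c y → ∣ c v - c w ∣ ≡ ∣ c x - c y ∣
  difference-unique {v} {w} {x} {y} v≢w x≢y with two-of-three-agree v w x | two-of-three-agree v w y
  ... | inj₁ v≡w        | _               = contradiction v≡w v≢w
  ... | inj₂ _          | inj₁ v≡w        = contradiction v≡w v≢w
  ... | inj₂ (inj₁ v≡x) | inj₂ (inj₁ v≡y) = contradiction (trans (sym v≡x) v≡y) x≢y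
  ... | inj₂ (inj₁ v≡x) | inj₂ (inj₂ w≡y) = cong₂ (λ m n → ∣ m - n ∣) v≡x w≡y
  ... | inj₂ (inj₂ w≡x) | inj₂ (inj₁ v≡y) = trans (ℤ.∣i-j∣≡∣j-i∣ (c v) (c w)) (cong₂ (λ m n → ∣ m - n ∣) w≡x v≡y)
  ... | inj₂ (inj₂ w≡x) | inj₂ (inj₂ w≡y) = contradiction (trans (sym w≡x) w≡y) x≢y

-- Bounds on the chromatic span, and its comparison with the chromatic number

Λ-≼ : (𝓕 : Pred Graph ℓ) (G : Graph) {c : V G → ℤ} {n : ℕ} →
      Proper G c → Free 𝓕 G c → span G c ≤ n → Λ G 𝓕 ≼ n
Λ-≼ 𝓕 G {c} proper free span≤n none =
  minimum-≼ (λ n → ∃ λ c → Proper G c × Free 𝓕 G c × span G c ≡ n) _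
    (c , proper , free , refl) λ (m , min , m≤span) → none (m , min , ℕ.≤-trans m≤span span≤n)

module _ (G : Graph) (c : V G → ℤ) where

  -- The colours of `c` may lie far apart; renaming them injectively to consecutive integers from 0
  -- keeps the colouring proper and free while the number of colours controls the span.
  rank : V G → ℤ
  rank v = + toℕ (colourIndex G c v)

  rank-injective : ∀ {v w} → rank v ≡ rank w → c v ≡ c w
  rank-injective = colourIndex-injective G c ∘ toℕ-injective ∘ ℤ.+-injective

  rank-free : (𝓕 : Pred Graph ℓ) → Free 𝓕 G c → Free 𝓕 G rank
  rank-free 𝓕 free S S∈𝓕 = ℕ.≤-trans (free S S∈𝓕)
    (numColours-mono (Subgraph.graph S) (Subgraph.graph S) id rank-injective)

  rank-span : ∀ {k} → numColours G c ≤ suc k → span G rank ≤ k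
  rank-span {k} n≤1+k = span-lub G rank λ {v} {w} _ →
    subst (λ i → ∣ i ∣ ≤ k) (sym (ℤ.m-n≡m⊖n (toℕ (colourIndex G c v)) (toℕ (colourIndex G c w))))
      (ℕ.≤-trans (ℤ.∣m⊝n∣≤m⊔n (toℕ (colourIndex G c v)) (toℕ (colourIndex G c w))) (ℕ.⊔-lub (index≤k v) (index≤k w)))
    where
    index≤k : ∀ v → toℕ (colourIndex G c v) ≤ k
    -- Indices start at 0, so with at most `suc k` colours the largest is at most `k`.
    index≤k v = s≤s⁻¹ (ℕ.≤-trans (toℕ<n (colourIndex G c v)) n≤1+k)

χ⇒Λ : (𝓕 : Pred Graph ℓ) (G : Graph) (k : ℕ) → χ G 𝓕 ≼ suc k → Λ G 𝓕 ≼ k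
χ⇒Λ 𝓕 G k χ≼ none = χ≼ λ (m , ((c , proper , free , n≤m) , _) , m≤1+k) →
  Λ-≼ 𝓕 G (λ e → proper e ∘ rank-injective G c) (rank-free G c 𝓕 free)
    (rank-span G c (ℕ.≤-trans n≤m m≤1+k)) none

-- Isomorphism and connectedness

≅-trans : ∀ {G H K} → G ≅ H → H ≅ K → G ≅ K
≅-trans G≅H H≅K = record
  { bijection = ↔-trans (_≅_.bijection G≅H) (_≅_.bijection H≅K)
  ; adjacency = λ v w → ⇔-trans (_≅_.adjacency G≅H v w) (_≅_.adjacency H≅K _ _)
  }

module _ {G H : Graph} (G≅H : G ≅ H) where
  open _≅_ G≅H

  from-Adj : ∀ {x y} → Adj H x y → Adj G (Inverse.from bijection x) (Inverse.from bijection y)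
  from-Adj e = Equivalence.from (adjacency _ _)
    (subst₂ (Adj H) (sym (Inverse.strictlyInverseˡ bijection _)) (sym (Inverse.strictlyInverseˡ bijection _)) e)

  ≅-connected : Connected H → Connected G
  ≅-connected conn v w = subst₂ (Star (Adj G))
    (Inverse.strictlyInverseʳ bijection v) (Inverse.strictlyInverseʳ bijection w)
    (gmap (Inverse.from bijection) from-Adj (conn (Inverse.to bijection v) (Inverse.to bijection w)))

-- A path between the two distinct vertices numbered 0 and 1 cannot be empty, and its first step is
-- an edge.
connected⇒edge : ∀ G → Connected G → 2 ≤ order G → ∃₂ λ v w → Adj G v w
connected⇒edge G conn 2≤n = firstStep (conn (vertex 0<n) (vertex 2≤n)) λ eq →
  0≢1 (fromℕ<-injective 0 1 0<n 2≤n (from-injective eq))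
  where
  0<n = ℕ.<⇒≤ 2≤n

  vertex : ∀ {i} → i < order G → V G
  vertex i<n = Inverse.from (Graph.finite G) (fromℕ< i<n)

  from-injective : ∀ {i j} → Inverse.from (Graph.finite G) i ≡ Inverse.from (Graph.finite G) j → i ≡ j
  from-injective {i} {j} eq = trans (sym (Inverse.strictlyInverseˡ (Graph.finite G) i))
    (trans (cong (Inverse.to (Graph.finite G)) eq) (Inverse.strictlyInverseˡ (Graph.finite G) j))

  0≢1 : 0 ≢ 1
  0≢1 ()

  firstStep : ∀ {v w} → Star (Adj G) v w → v ≢ w → ∃₂ λ v w → Adj G v w
  firstStep ε       v≢v = contradiction refl v≢v
  firstStep (e ◅ _) _   = _ , _ , e

-- Fibres of the cartesian product

□-V-ext : ∀ {d} (Gs : Vec Graph d) {v w : □-V Gs} → (∀ i → π Gs v i ≡ π Gs w i) → v ≡ w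
□-V-ext []       eq = refl
□-V-ext (G ∷ Gs) eq = cong₂ _,_ (eq zero) (□-V-ext Gs (eq ∘ suc))

-- The map `update Gs u i` embeds the factor in direction `i` as the fibre through `u`.
update : ∀ {d} (Gs : Vec Graph d) → □-V Gs → ∀ i → V (lookup Gs i) → □-V Gs
update (G ∷ Gs) (_ , vs) zero    x = x , vs
update (G ∷ Gs) (v , vs) (suc i) x = v , update Gs vs i x

π-update : ∀ {d} (Gs : Vec Graph d) v i x → π Gs (update Gs v i x) i ≡ x
π-update (G ∷ Gs) v zero    x = refl
π-update (G ∷ Gs) v (suc i) x = π-update Gs _ i x

π-update-≢ : ∀ {d} (Gs : Vec Graph d) v i x {j} → j ≢ i → π Gs (update Gs v i x) j ≡ π Gs v j
π-update-≢ (G ∷ Gs) v zero    x {zero}  j≢i = contradiction refl j≢i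
π-update-≢ (G ∷ Gs) v zero    x {suc j} j≢i = refl
π-update-≢ (G ∷ Gs) v (suc i) x {zero}  j≢i = refl
π-update-≢ (G ∷ Gs) v (suc i) x {suc j} j≢i = π-update-≢ Gs _ i x (j≢i ∘ cong suc)

update-π : ∀ {d} (Gs : Vec Graph d) u i {v} → (∀ j → j ≢ i → π Gs u j ≡ π Gs v j) →
           update Gs u i (π Gs v i) ≡ v
update-π Gs u i {v} agree = □-V-ext Gs λ j → coordinate j
  where
  coordinate : ∀ j → π Gs (update Gs u i (π Gs v i)) j ≡ π Gs v j
  coordinate j with j Fin.≟ i
  ... | yes refl = π-update Gs u i _
  ... | no j≢i   = trans (π-update-≢ Gs u i _ j≢i) (agree j j≢i)

-- Two points of the fibre agree in every coordinate `j ≢ i`, so an edge in such a direction would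
-- project to a loop.
update-Adj⁻ : ∀ {d} (Gs : Vec Graph d) u i {x y} →
              □-Adj Gs (update Gs u i x) (update Gs u i y) → Adj (lookup Gs i) x y
update-Adj⁻ Gs u i {x} {y} (j , e , _) with j Fin.≟ i
... | yes refl = subst₂ (Adj (lookup Gs i)) (π-update Gs u i x) (π-update Gs u i y) e
... | no j≢i   = ⊥-elim (Graph.Adj-irr (lookup Gs j)
                   (trans (π-update-≢ Gs u i x j≢i) (sym (π-update-≢ Gs u i y j≢i))) e)

-- The intersection of S with the fibre through u in direction i, projected to G_i.
module Slice {d} (Gs : Vec Graph d) (S : Subgraph (□ Gs)) (i : Fin d)
             (u : □-V Gs) (u∈S : T (Subgraph.inV S u)) where
  open Subgraph S using (inV; inE; E⊆Adj; E⊆V; E-sym)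

  slice : Subgraph (lookup Gs i)
  slice = record
    { inV      = λ x → inV (update Gs u i x)
    ; inE      = λ x y → inE (update Gs u i x) (update Gs u i y)
    ; nonempty = π Gs u i , subst (T ∘ inV) (sym (update-π Gs u i λ _ _ → refl)) u∈S
    ; E⊆Adj    = update-Adj⁻ Gs u i ∘ E⊆Adj
    ; E⊆V      = E⊆V
    ; E-sym    = E-sym
    }

  embed : V (Subgraph.graph slice) → V (Subgraph.graph S)
  embed (x , x∈) = update Gs u i x , x∈

  -- When all of `S` lies in the fibre, projection to coordinate `i` inverts `embed`. Adjacency in
  -- the slice is by definition that of the images in `S`.
  slice-≅ : (∀ {v} → T (inV v) → ∀ j → j ≢ i → π Gs u j ≡ π Gs v j) → Subgraph.graph slice ≅ Subgraph.graph S
  slice-≅ inFibre = record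
    { bijection = mk↔ₛ′ embed
        (λ (v , v∈) → π Gs v i , subst (T ∘ inV) (sym (update-π Gs u i (inFibre v∈))) v∈)
        (λ (v , v∈) → T-Σ-≡ (update-π Gs u i (inFibre v∈)))
        (λ (x , x∈) → T-Σ-≡ (π-update Gs u i x))
    ; adjacency = λ _ _ → mk⇔ id id
    }
    where
    T-Σ-≡ : ∀ {A : Set} {p : A → _} {v w : A} {v∈ : T (p v)} {w∈ : T (p w)} → v ≡ w → (v , v∈) ≡ (w , w∈)
    T-Σ-≡ {v∈ = v∈} {w∈} refl = cong (_ ,_) (T-irrelevant v∈ w∈)

-- The combined colouring of the product

combine : ∀ {d} (Gs : Vec Graph d) → Vec ℕ d → (∀ i → V (lookup Gs i) → ℤ) → □-V Gs → ℤ
combine []       []       c _        = 0ℤ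
combine (G ∷ Gs) (s ∷ ss) c (v , vs) = + s ℤ.* c zero v ℤ.+ combine Gs ss (c ∘ suc) vs

-- The summands of the coordinates other than `i` cancel.
combine-difference : ∀ {d} (Gs : Vec Graph d) s c i {v w} → (∀ j → j ≢ i → π Gs v j ≡ π Gs w j) →
  combine Gs s c v - combine Gs s c w ≡ + lookup s i ℤ.* (c i (π Gs v i) - c i (π Gs w i))
combine-difference (G ∷ Gs) (s ∷ ss) c zero {v , vs} {w , ws} agree
  with refl ← □-V-ext Gs {vs} {ws} (λ j → agree (suc j) λ ()) =
  factor (+ s) (c zero v) (c zero w) (combine Gs ss (c ∘ suc) vs)
  where
  factor : ∀ m x y z → (m ℤ.* x ℤ.+ z) - (m ℤ.* y ℤ.+ z) ≡ m ℤ.* (x - y)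
  factor = solve-∀
combine-difference (G ∷ Gs) (s ∷ ss) c (suc i) {v , vs} {w , ws} agree
  with refl ← agree zero (λ ()) =
  trans (cancel (+ s ℤ.* c zero v) _ _)
        (combine-difference Gs ss (c ∘ suc) i λ j j≢i → agree (suc j) (j≢i ∘ Fin.suc-injective))
  where
  cancel : ∀ p x y → (p ℤ.+ x) - (p ℤ.+ y) ≡ x - y
  cancel = solve-∀

i≢j⇒1≤∣i-j∣ : ∀ {i j} → i ≢ j → 1 ≤ ∣ i - j ∣
i≢j⇒1≤∣i-j∣ i≢j = ℕ.n≢0⇒n>0 (i≢j ∘ ℤ.i-j≡0⇒i≡j _ _ ∘ ℤ.∣i∣≡0⇒i≡0)

module Combine {d} (𝓕 : Pred Graph ℓ) (forbidden : ForbiddenFamily 𝓕) (k : ℕ) (Gs : Vec Graph d)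
               (Λ≤k : ∀ i → ∃ λ m → Λ (lookup Gs i) 𝓕 m × m ≤ k)
               (s : Vec ℕ d) (s-unique : Unique s) (s-sidon : Sidon k (_∈ s)) where

  c : ∀ i → V (lookup Gs i) → ℤ
  c i = let _ , ((c , _) , _) , _ = Λ≤k i in c

  c-proper : ∀ i → Proper (lookup Gs i) (c i)
  c-proper i = let _ , ((_ , proper , _) , _) , _ = Λ≤k i in proper

  c-free : ∀ i → Free 𝓕 (lookup Gs i) (c i)
  c-free i = let _ , ((_ , _ , free , _) , _) , _ = Λ≤k i in free

  c-span : ∀ i → span (lookup Gs i) (c i) ≤ k
  c-span i = let _ , ((_ , _ , _ , eq) , _) , m≤k = Λ≤k i in ℕ.≤-trans (ℕ.≤-reflexive eq) m≤k

  C : □-V Gs → ℤ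
  C = combine Gs s c

  s≥1 : ∀ i → 1 ≤ lookup s i
  s≥1 i = proj₁ s-sidon _ (Vec.∈-lookup i s)

  ∣C-C∣ : ∀ i {v w} → (∀ j → j ≢ i → π Gs v j ≡ π Gs w j) →
          ∣ C v - C w ∣ ≡ ∣ c i (π Gs v i) - c i (π Gs w i) ∣ * lookup s i
  ∣C-C∣ i agree = trans (cong ∣_∣ (combine-difference Gs s c i agree))
    -- The factors are swapped to fit the shape `a * x` in `Sidon`.
    (trans (ℤ.abs-* (+ lookup s i) _) (ℕ.*-comm (lookup s i) _))

  -- The multiplier `lookup s i` is positive, so a zero difference of `C` forces a zero difference
  -- of `c i`.
  C-reflects : ∀ i {v w} → (∀ j → j ≢ i → π Gs v j ≡ π Gs w j) → C v ≡ C w → c i (π Gs v i) ≡ c i (π Gs w i)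
  C-reflects i agree Cv≡Cw = ℤ.i-j≡0⇒i≡j _ _ (ℤ.∣i∣≡0⇒i≡0
    (ℕ.m*n≡0⇒m≡0 _ (lookup s i) {{>-nonZero (s≥1 i)}}
      (trans (sym (∣C-C∣ i agree)) (cong ∣_∣ (ℤ.i≡j⇒i-j≡0 Cv≡Cw)))))

  C-proper : Proper (□ Gs) C
  C-proper (i , e , agree) = c-proper i e ∘ C-reflects i agree

  C-span : span (□ Gs) C ≤ k * max 0 (toList s)
  C-span = span-lub (□ Gs) C λ (i , e , agree) →
    ℕ.≤-trans (ℕ.≤-reflexive (∣C-C∣ i agree))
      (ℕ.*-mono-≤ (ℕ.≤-trans (∣c-c∣≤span (lookup Gs i) (c i) e) (c-span i))
        (All.lookup (xs≤max 0 (toList s)) (Vec.∈-toList⁺ (Vec.∈-lookup i s))))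

  -- Each difference is `a * lookup s i` with `a` at least 1 because `c i` is proper and at most `k`
  -- by its span. The Sidon property then identifies the multipliers, and distinctness of the
  -- entries of `s` identifies the directions.
  direction-unique : ∀ {v w x y} (e : □-Adj Gs v w) (f : □-Adj Gs x y) →
                     ∣ C v - C w ∣ ≡ ∣ C x - C y ∣ → proj₁ e ≡ proj₁ f
  direction-unique (i , e , agree-e) (j , f , agree-f) eq = lookup-injective s-unique i j
    (proj₂ (proj₂ s-sidon _ _ _ _ (Vec.∈-lookup i s) (Vec.∈-lookup j s) (bounds i e) (bounds j f)
      (trans (sym (∣C-C∣ i agree-e)) (trans eq (∣C-C∣ j agree-f)))))
    where
    bounds : ∀ i {x y} → Adj (lookup Gs i) x y → 1 ≤ ∣ c i x - c i y ∣ × ∣ c i x - c i y ∣ ≤ k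
    bounds i e = i≢j⇒1≤∣i-j∣ (c-proper i e) , ℕ.≤-trans (∣c-c∣≤span (lookup Gs i) (c i) e) (c-span i)

  C-free : Free 𝓕 (□ Gs) C
  -- With fewer than three colours, `S` would be isomorphic to its slice. The slice has at least
  -- three colours under `c i`, and `embed` carries this count back to `S`, a contradiction.
  C-free S (H , H∈𝓕 , S≅H) = decidable-stable (3 ≤? numColours S′ C′) λ 3≰n →
    3≰n (ℕ.≤-trans (c-free i slice (H , H∈𝓕 , ≅-trans (slice-≅ (inFibre (ℕ.≰⇒> 3≰n) ∘ path)) S≅H))
      (numColours-mono (Subgraph.graph slice) S′ embed λ {x} {y} → embed-reflects {x} {y}))
    where
    S′ = Subgraph.graph S
    C′ = C ∘ proj₁

    connected : Connected H
    connected = proj₁ (forbidden H H∈𝓕)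

    edge : ∃₂ λ v w → Adj S′ v w
    edge with _ , _ , 3≤n ← forbidden H H∈𝓕
         with x , y , xy ← connected⇒edge H connected (ℕ.<⇒≤ 3≤n) =
      from≅ x , from≅ y , from-Adj S≅H xy
      where from≅ = Inverse.from (_≅_.bijection S≅H)

    -- The direction of this one edge is the reference for all of `S`; the base point `u` of the
    -- fibre can be any vertex of `S`.
    e₀ = Subgraph.E⊆Adj S (proj₂ (proj₂ edge))
    i = proj₁ e₀
    u = proj₁ (Subgraph.nonempty S)
    open Slice Gs S i u (proj₂ (Subgraph.nonempty S))

    path : ∀ {v} (v∈ : T (Subgraph.inV S v)) → Star (Adj S′) (Subgraph.nonempty S) (v , v∈)
    path v∈ = ≅-connected S≅H connected (Subgraph.nonempty S) (_ , v∈)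

    -- With so few colours every edge on the path has the same colour difference as `e₀`, hence
    -- direction `i`, and so leaves the other coordinates fixed.
    inFibre : numColours S′ C′ < 3 → ∀ {v w} → Star (Adj S′) v w →
              ∀ j → j ≢ i → π Gs (proj₁ v) j ≡ π Gs (proj₁ w) j
    inFibre few ε           j j≢i = refl
    inFibre few {v} (_◅_ {j = x} vx xw) j j≢i =
      trans (proj₂ (proj₂ e) j (j≢i ∘ λ j≡ → trans j≡ (sym i≡))) (inFibre few xw j j≢i)
      where
      e = Subgraph.E⊆Adj S vx

      i≡ : i ≡ proj₁ e
      i≡ = direction-unique e₀ e
        (difference-unique S′ C′ few {proj₁ edge} {proj₁ (proj₂ edge)} {v} {x} (C-proper e₀) (C-proper e))

    embed-reflects : ∀ {x y} → C′ (embed x) ≡ C′ (embed y) → c i (proj₁ x) ≡ c i (proj₁ y)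
    embed-reflects {x , _} {y , _} eq =
      subst₂ (λ x y → c i x ≡ c i y) (π-update Gs u i x) (π-update Gs u i y)
        (C-reflects i (λ j j≢i → trans (π-update-≢ Gs u i x j≢i) (sym (π-update-≢ Gs u i y j≢i))) eq)

  Λ-□ : Λ (□ Gs) 𝓕 ≼ k * max 0 (toList s)
  Λ-□ = Λ-≼ 𝓕 (□ Gs) C-proper C-free C-span

lemma2 : ∀ {ℓ} (𝓕 : Pred Graph ℓ) → ForbiddenFamily 𝓕 →
    (k d : ℕ) → 1 ≤ k → 1 ≤ d →
    (G : Vec Graph d) →
    (∀ i → χ (lookup G i) 𝓕 ≼ suc k → Λ (lookup G i) 𝓕 ≼ k) ×
    ((∀ i → Λ (lookup G i) 𝓕 ≼ k) →
    (s : Vec ℕ d) → Unique s → Sidon k (_∈ s) →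
    Λ (□ G) 𝓕 ≼ k * max 0 (toList s))
lemma2 𝓕 forbidden k d _ _ G =
  (λ i → χ⇒Λ 𝓕 (lookup G i) k) ,
  -- Double negation commutes with the finite quantifier over `Fin d`, and the goal is itself a
  -- double negation, so optimal colourings of all factors may be taken as given at once.
  λ Λ≼k s s-unique s-sidon none → sequence (RawMonad.rawApplicative ¬¬-Monad) Λ≼k λ Λ≤k →
    Combine.Λ-□ 𝓕 forbidden k G Λ≤k s s-unique s-sidon none
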